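{- Let $G$ be a finite graph with $n$ vertices such that $\mathrm{Aut}(G)$ is cyclic of order $t$, generated by $\pi$, and let $t=\prod_{i=1}^s p_i^{r_i}$ be the prime factorization of $t$ (distinct primes $p_i$, $r_i\ge1$). Let $P^*=\{\pi^{t/p_1},\pi^{t/p_2},\dots,\pi^{t/p_s}\}$. Then for every positive integer $k$, $$L(G,k)=\sum_{P\subseteq P^*}(-1)^{|P|}N_{\ge}(P).$$
   Context: A $k$-labeling of $G$ is a map $\phi:V(G)\to\{1,\dots,k\}$; an automorphism $\pi$ preserves $\phi$ if $\phi(\pi(v))=\phi(v)$ for all $v$; $\phi$ is distinguishing if only the identity preserves it; $L(G,k)$ is the number of distinguishing $k$-labelings. For $P\subseteq\mathrm{Aut}(G)$, $N_{\ge}(P)$ denotes the number of $k$-labelings of $G$ preserved by every automorphism in $P$ (so $N_{\ge}(\emptyset)=k^n$). -}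

module Defs where

open import Algebra.Bundles using (Group)
import Algebra.Definitions.RawMonoid as RawMonoidDefs
open import Data.Fin.Base using (Fin; finToFun; funToFin)
open import Data.Fin.Permutation as Perm using (Permutation′; _⟨$⟩ʳ_; _⟨$⟩ˡ_)
open import Data.Fin.Properties using (_≟_; all?; finToFun-funToFin)
open import Data.Integer.Base as ℤ using (ℤ; +_; -[1+_])
open import Data.List.Base using (List; []; _∷_; _++_; map; filter; foldr; length; tabulate; allFin; deduplicate)
open import Data.List.Relation.Unary.All as All using (All)
open import Data.Nat.Base using (ℕ; suc; _^_; _/_; _≤_)
open import Data.Nat.ListAction using (product)
open import Data.Nat.Primality using (Prime; prime⇒nonZero)
open import Data.Product.Base using (_×_; _,_; ∃)
open import Function.Base using (_∘_)
open import Function.Bundles using (_⇔_; mk⇔; Equivalence; Inverse)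
open import Function.Definitions using (Injective)
open import Level using (0ℓ)
open import Relation.Binary.Core using (Rel)
open import Relation.Binary.Definitions using (Decidable; Symmetric; Irreflexive)
open import Relation.Binary.PropositionalEquality using (_≡_; refl; sym; trans; cong; subst₂) renaming (setoid to ≡-setoid)
open import Relation.Nullary.Decidable using (Dec; map′; _×-dec_; _→-dec_)
import Relation.Unary as Unary

record Graph (n : ℕ) : Set₁ where
  infix 4 _~_ _~?_
  field
    _~_      : Rel (Fin n) 0ℓ
    ~-sym    : Symmetric _~_
    ~-irrefl : Irreflexive _≡_ _~_
    _~?_     : Decidable _~_

record Automorphism {n : ℕ} (G : Graph n) : Set where
  open Graph G
  field
    perm     : Permutation′ n
    adjacent : ∀ u v → (u ~ v) ⇔ (perm ⟨$⟩ʳ u ~ perm ⟨$⟩ʳ v)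

module _ {n : ℕ} (G : Graph n) where
  open Graph G
  open Automorphism

  private
    idA : Automorphism G
    idA = record { perm = Perm.id ; adjacent = λ _ _ → mk⇔ (λ e → e) (λ e → e) }

    infixr 9 _∘A_
    _∘A_ : Automorphism G → Automorphism G → Automorphism G
    σ ∘A τ = record
      { perm     = τ .perm Perm.∘ₚ σ .perm
      ; adjacent = λ u v →
          let module T = Equivalence (τ .adjacent u v)
              module S = Equivalence (σ .adjacent (τ .perm ⟨$⟩ʳ u) (τ .perm ⟨$⟩ʳ v))
          in mk⇔ (λ e → S.to (T.to e)) (λ e → T.from (S.from e))
      }

    invA : Automorphism G → Automorphism G
    invA σ = record
      { perm     = Perm.flip (σ .perm)
      ; adjacent = λ u v →
          let module S = Equivalence (σ .adjacent (σ .perm ⟨$⟩ˡ u) (σ .perm ⟨$⟩ˡ v))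
          in mk⇔ (λ e → S.from (subst₂ _~_ (sym (Perm.inverseʳ (σ .perm))) (sym (Perm.inverseʳ (σ .perm))) e))
                 (λ e → subst₂ _~_ (Perm.inverseʳ (σ .perm)) (Perm.inverseʳ (σ .perm)) (S.to e))
      }

  Aut : Group 0ℓ 0ℓ
  Aut = record
    { Carrier = Automorphism G
    ; _≈_     = λ σ τ → σ .perm Perm.≈ τ .perm
    ; _∙_     = _∘A_
    ; ε       = idA
    ; _⁻¹     = invA
    ; isGroup = record
      { isMonoid = record
        { isSemigroup = record
          { isMagma = record
            { isEquivalence = record
              { refl  = λ _ → refl
              ; sym   = λ p v → sym (p v)
              ; trans = λ p q v → trans (p v) (q v)
              }
            ; ∙-cong = λ {σ} {σ′} {τ} {τ′} p q v →
                trans (cong (σ .perm ⟨$⟩ʳ_) (q v)) (p (τ′ .perm ⟨$⟩ʳ v))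
            }
          ; assoc = λ _ _ _ _ → refl
          }
        ; identity = (λ _ _ → refl) , (λ _ _ → refl)
        }
      ; inverse = (λ σ _ → Perm.inverseˡ (σ .perm)) , (λ σ _ → Perm.inverseʳ (σ .perm))
      ; ⁻¹-cong = λ {σ} {τ} p v →
          trans (cong (σ .perm ⟨$⟩ˡ_)
                      (trans (sym (Perm.inverseʳ (τ .perm))) (sym (p (τ .perm ⟨$⟩ˡ v)))))
                (Perm.inverseˡ (σ .perm))
      }
    }

module _ {c ℓ} (𝒢 : Group c ℓ) where
  open Group 𝒢
  open RawMonoidDefs rawMonoid using () renaming (_×_ to _times_)

  power : Carrier → ℕ → Carrier
  power g m = m times g

  powerℤ : Carrier → ℤ → Carrier
  powerℤ g (+ m)    = power g m
  powerℤ g -[1+ m ] = power g (suc m) ⁻¹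

  HasOrder : ℕ → Set _
  HasOrder t = Inverse setoid (≡-setoid (Fin t))

  GeneratedBy : Carrier → Set _
  GeneratedBy g = ∀ x → ∃ λ z → x ≈ powerℤ g z

record PrimeFactorization (t : ℕ) : Set where
  field
    s          : ℕ
    p          : Fin s → ℕ
    r          : Fin s → ℕ
    p-prime    : ∀ i → Prime (p i)
    p-distinct : Injective _≡_ _≡_ p
    r-positive : ∀ i → 1 ≤ r i
    factors    : t ≡ product (tabulate λ i → p i ^ r i)

Labeling : ℕ → ℕ → Set
Labeling n k = Fin n → Fin k

-- finToFun and funToFin are mutually inverse (up to pointwise equality of
-- functions), so every labeling is listed exactly once.
labelings : ∀ n k → List (Labeling n k)
labelings n k = map (finToFun {k} {n}) (allFin (k ^ n))

count : ∀ {n k} {P : Unary.Pred (Labeling n k) 0ℓ} → Unary.Decidable P → ℕ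
count {n} {k} P? = length (filter P? (labelings n k))

module _ {n : ℕ} (G : Graph n) where
  open Graph G
  open Automorphism
  open Group (Aut G) using (_≈_; ε)

  infix 4 _≈?_
  _≈?_ : Decidable _≈_
  σ ≈? τ = all? λ v → σ .perm ⟨$⟩ʳ v ≟ τ .perm ⟨$⟩ʳ v

  Preserves : ∀ {k} → Automorphism G → Labeling n k → Set
  Preserves σ φ = ∀ v → φ (σ .perm ⟨$⟩ʳ v) ≡ φ v

  preserves? : ∀ {k} (σ : Automorphism G) (φ : Labeling n k) → Dec (Preserves σ φ)
  preserves? σ φ = all? λ v → φ (σ .perm ⟨$⟩ʳ v) ≟ φ v

  Distinguishing : ∀ {k} → Labeling n k → Set
  Distinguishing φ = ∀ σ → Preserves σ φ → σ ≈ ε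

  -- Decided by running through all pairs (f , g) of mutually inverse
  -- self-maps of the vertex set.
  distinguishing? : ∀ {k} → Unary.Decidable (Distinguishing {k})
  distinguishing? {k} φ = map′ to from (all? λ a → all? λ b → test? (finToFun a) (finToFun b))
    where
    IsAut : (f g : Fin n → Fin n) → Set
    IsAut f g = (∀ v → f (g v) ≡ v) × (∀ v → g (f v) ≡ v)
              × (∀ u v → (u ~ v → f u ~ f v) × (f u ~ f v → u ~ v))

    Test : (f g : Fin n → Fin n) → Set
    Test f g = IsAut f g × (∀ v → φ (f v) ≡ φ v) → ∀ v → f v ≡ v

    test? : ∀ f g → Dec (Test f g)
    test? f g =
      ((all? (λ v → f (g v) ≟ v) ×-dec all? (λ v → g (f v) ≟ v)
        ×-dec all? (λ u → all? λ v → ((u ~? v) →-dec (f u ~? f v)) ×-dec ((f u ~? f v) →-dec (u ~? v))))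
       ×-dec all? (λ v → φ (f v) ≟ φ v))
      →-dec all? (λ v → f v ≟ v)

    to : (∀ a b → Test (finToFun a) (finToFun b)) → Distinguishing φ
    to h σ pres v = trans (sym (F v)) (h (funToFin f) (funToFin g) ((fg , gf , adj) , pr) v)
      where
      f g f′ g′ : Fin n → Fin n
      f = σ .perm ⟨$⟩ʳ_
      g = σ .perm ⟨$⟩ˡ_
      f′ = finToFun (funToFin f)
      g′ = finToFun (funToFin g)
      F : ∀ v → f′ v ≡ f v
      F = finToFun-funToFin f
      H : ∀ v → g′ v ≡ g v
      H = finToFun-funToFin g
      fg : ∀ v → f′ (g′ v) ≡ v
      fg v = trans (F (g′ v)) (trans (cong f (H v)) (Perm.inverseʳ (σ .perm)))
      gf : ∀ v → g′ (f′ v) ≡ v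
      gf v = trans (H (f′ v)) (trans (cong g (F v)) (Perm.inverseˡ (σ .perm)))
      adj : ∀ u v → (u ~ v → f′ u ~ f′ v) × (f′ u ~ f′ v → u ~ v)
      adj u v = (λ e → subst₂ _~_ (sym (F u)) (sym (F v)) (S.to e))
              , (λ e → S.from (subst₂ _~_ (F u) (F v) e))
        where module S = Equivalence (σ .adjacent u v)
      pr : ∀ v → φ (f′ v) ≡ φ v
      pr v = trans (cong φ (F v)) (pres v)

    from : Distinguishing φ → ∀ a b → Test (finToFun a) (finToFun b)
    from d a b ((fg , gf , adj) , pr) = d σ pr
      where
      σ : Automorphism G
      σ = record
        { perm     = Perm.permutation (finToFun a) (finToFun b) fg gf
        ; adjacent = λ u v → let (x , y) = adj u v in mk⇔ x y
        }

  L : ℕ → ℕ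
  L k = count (distinguishing? {k})

  N≥ : ℕ → List (Automorphism G) → ℕ
  N≥ k P = count {n} {k} λ φ → All.all? (λ σ → preserves? σ φ) P

  -- A finite set of automorphisms is a list without repetitions up to ≈.
  P* : Automorphism G → ∀ {t} → PrimeFactorization t → List (Automorphism G)
  P* π {t} fac = deduplicate _≈?_ (tabulate λ i →
      power (Aut G) π (_/_ t (p i) {{prime⇒nonZero (p-prime i)}}))
    where open PrimeFactorization fac

-- Applied to a repetition-free list, lists every subset of it exactly once.
subsets : ∀ {a} {A : Set a} → List A → List (List A)
subsets []       = [] ∷ []
subsets (x ∷ xs) = subsets xs ++ map (x ∷_) (subsets xs)

∑ : ∀ {a} {A : Set a} → List A → (A → ℤ) → ℤ
∑ xs f = foldr ℤ._+_ ℤ.0ℤ (map f xs)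

{-# OPTIONS --safe #-}

-- Inclusion–exclusion over P* counts the labelings preserved by no element of
-- P*, so it remains to see that these are exactly the distinguishing ones.
-- No element of P* is the identity, which gives one direction.  Conversely the
-- automorphisms preserving a labeling form a subgroup; if it contains πᵐ with
-- t ∤ m then, by Bézout, it contains π^d for the proper divisor d = gcd(m, t)
-- of t, and hence π^(t/q) for every prime q dividing t/d.

module Submission where

open import Defs
open import Data.Nat.Base using (ℕ; _≤_)
open import Data.Integer.Base using (+_; -1ℤ; _*_; _^_)
open import Data.List.Base using (length)
open import Relation.Binary.PropositionalEquality using (_≡_)

open import Algebra.Bundles using (Group)
import Algebra.Properties.Group as GroupProperties
import Algebra.Properties.Monoid.Mult as MonoidMult
open import Data.Bool.Base using (true; false)
open import Data.Fin.Base using (Fin; zero; suc; toℕ; fromℕ<)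
open import Data.Fin.Permutation using (_⟨$⟩ʳ_; _⟨$⟩ˡ_; inverseʳ)
open import Data.Fin.Properties using (pigeonhole; injective⇒≤; toℕ<n; toℕ-fromℕ<; nonZeroIndex)
import Data.Integer.Base as ℤ
import Data.Integer.Properties as ℤ
import Data.Integer.Tactic.RingSolver as ℤ-Solver
open import Data.List.Base using (List; []; _∷_; _++_; foldr; map; filter; tabulate)
open import Data.List.Membership.Propositional.Properties using (∈-tabulate⁺)
open import Data.List.Properties using (filter-≐; map-∘; map-cong)
open import Data.List.Relation.Unary.All as All using (All; []; _∷_)
import Data.List.Relation.Unary.All.Properties as All
import Data.Nat.Base as ℕ
open import Data.Nat.Base using (zero; suc; NonZero; _∸_; _%_; _/_; >-nonZero; nonTrivial⇒n>1)
open import Data.Nat.Divisibility using (_∣_; divides; ∣-trans; ∣⇒≤; ∣1⇒≡1; m∣m*n; *-monoʳ-∣; m*n∣o⇒m∣o/n; quotient; quotient≢0; m∣n⇒n≡m*quotient)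
open import Data.Nat.DivMod using (m≡m%n+[m/n]*n; m%n<n; m/n<m; m≥n⇒m/n>0)
open import Data.Nat.GCD using (gcd; gcd-GCD; gcd[m,n]∣m; gcd[m,n]∣n; module Bézout)
open import Data.Nat.ListAction using (product)
open import Data.Nat.ListAction.Properties using (∈⇒∣product)
open import Data.Nat.Primality using (Prime; euclidsLemma; prime⇒irreducible; prime⇒nonZero; prime⇒nonTrivial; ¬prime[1])
open import Data.Nat.Primality.Factorisation using (factorise)
import Data.Nat.Properties as ℕ
open import Data.Product.Base using (_×_; _,_; ∃; proj₁; proj₂)
open import Data.Sum.Base using (inj₁; inj₂)
open import Function.Base using (_∘_)
open import Function.Bundles using (Inverse)
open import Level using (Level; _⊔_)
open import Relation.Binary.Definitions using (_Respects_)
open import Relation.Binary.PropositionalEquality using (_≢_; refl; sym; trans; cong; cong₂; subst; module ≡-Reasoning)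
open import Relation.Nullary using (¬_; Dec; yes; no; does; ¬?; contradiction)
open import Relation.Unary using (Pred; Decidable; _≐_)

private
  variable
    a b ℓ ℓ₁ ℓ₂ : Level
    A : Set a
    B : Set b

-- Inclusion–exclusion

∑-++ : ∀ (xs ys : List A) f → ∑ (xs ++ ys) f ≡ ∑ xs f ℤ.+ ∑ ys f
∑-++ []       ys f = sym (ℤ.+-identityˡ _)
∑-++ (x ∷ xs) ys f = trans (cong (λ i → f x ℤ.+ i) (∑-++ xs ys f)) (sym (ℤ.+-assoc (f x) _ _))

∑-neg : ∀ (xs : List A) f → ∑ xs (λ x → ℤ.- f x) ≡ ℤ.- ∑ xs f
∑-neg []       f = refl
∑-neg (x ∷ xs) f = trans (cong (λ i → ℤ.- f x ℤ.+ i) (∑-neg xs f)) (sym (ℤ.neg-distrib-+ (f x) _))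

∑-map : ∀ (g : A → B) xs f → ∑ (map g xs) f ≡ ∑ xs (f ∘ g)
∑-map g xs f = cong (foldr ℤ._+_ ℤ.0ℤ) (sym (map-∘ xs))

∑-cong : ∀ (xs : List A) {f g} → (∀ x → f x ≡ g x) → ∑ xs f ≡ ∑ xs g
∑-cong xs f≗g = cong (foldr ℤ._+_ ℤ.0ℤ) (map-cong f≗g xs)

length-filter-split : ∀ {P : Pred A ℓ₁} {Q : Pred A ℓ₂} (P? : Decidable P) (Q? : Decidable Q) xs →
  length (filter P? xs) ≡ length (filter P? (filter Q? xs)) ℕ.+ length (filter P? (filter (¬? ∘ Q?) xs))
length-filter-split P? Q? []       = refl
length-filter-split P? Q? (x ∷ xs) with ih ← length-filter-split P? Q? xs | does (Q? x)
... | true  with does (P? x)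
...   | true  = cong suc ih
...   | false = ih
length-filter-split P? Q? (x ∷ xs) | false with does (P? x)
...   | true  = trans (cong suc ih) (sym (ℕ.+-suc _ _))
...   | false = ih

module _ {R : A → B → Set ℓ} (R? : ∀ x y → Dec (R x y)) where

  -- Kept general in the relation because the induction below applies it both to `R?` and to its
  -- complement.
  filter-all?-∷ : ∀ x xs ys →
    filter (λ y → All.all? (λ z → R? z y) (x ∷ xs)) ys ≡
    filter (λ y → All.all? (λ z → R? z y) xs) (filter (R? x) ys)
  filter-all?-∷ x xs []       = refl
  filter-all?-∷ x xs (y ∷ ys) with ih ← filter-all?-∷ x xs ys | does (R? x y)
  ... | false = ih
  ... | true  with does (All.all? (λ z → R? z y) xs)
  ...   | true  = cong (y ∷_) ih
  ...   | false = ih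

module _ {R : A → B → Set ℓ} (R? : ∀ x y → Dec (R x y)) where

  #all #none : List A → List B → ℕ
  #all  xs ys = length (filter (λ y → All.all? (λ x → R? x y) xs) ys)
  #none xs ys = length (filter (λ y → All.all? (λ x → ¬? (R? x y)) xs) ys)

  -- Induction on `xs` with `ys` left free, since the step needs the claim for the sublist `ys₁` of
  -- entries related to `x` as well as for `ys`. Subsets avoiding `x` contribute `#none xs ys`,
  -- those containing `x` contribute minus `#none xs ys₁`, and the difference counts the entries
  -- unrelated to `x` and to all of `xs`.
  inclusion-exclusion : ∀ xs ys →
    ∑ (subsets xs) (λ P → (-1ℤ ^ length P) * + #all P ys) ≡ + #none xs ys
  inclusion-exclusion []       ys = begin
    ℤ.1ℤ * + #all [] ys ℤ.+ ℤ.0ℤ  ≡⟨ ℤ.+-identityʳ _ ⟩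
    ℤ.1ℤ * + #all [] ys           ≡⟨ ℤ.*-identityˡ _ ⟩
    + #all [] ys                  ≡⟨ cong (+_ ∘ length) (filter-≐ _ _ ((λ _ → []) , (λ _ → [])) ys) ⟩
    + #none [] ys                 ∎
    where open ≡-Reasoning
  inclusion-exclusion (x ∷ xs) ys = begin
    ∑ (subsets xs ++ map (x ∷_) (subsets xs)) (term ys)
      ≡⟨ ∑-++ (subsets xs) _ (term ys) ⟩
    ∑ (subsets xs) (term ys) ℤ.+ ∑ (map (x ∷_) (subsets xs)) (term ys)
      ≡⟨ cong₂ ℤ._+_ (inclusion-exclusion xs ys) with-x ⟩
    + #none xs ys ℤ.+ ℤ.- + #none xs ys₁
      ≡⟨ cong (λ m → + m ℤ.+ ℤ.- + #none xs ys₁) (length-filter-split _ (R? x) ys) ⟩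
    (+ #none xs ys₁ ℤ.+ + #none xs ys₀) ℤ.+ ℤ.- + #none xs ys₁
      ≡⟨ cancel (+ #none xs ys₁) (+ #none xs ys₀) ⟩
    + #none xs ys₀
      ≡⟨ cong (+_ ∘ length) (filter-all?-∷ (λ z y → ¬? (R? z y)) x xs ys) ⟨
    + #none (x ∷ xs) ys ∎
    where
    open ≡-Reasoning
    ys₀ ys₁ : List B
    ys₁ = filter (R? x) ys
    ys₀ = filter (¬? ∘ R? x) ys

    term : List B → List A → ℤ.ℤ
    term zs P = (-1ℤ ^ length P) * + #all P zs

    cancel : ∀ i j → (i ℤ.+ j) ℤ.+ ℤ.- i ≡ j
    cancel = ℤ-Solver.solve-∀

    -- The extra member flips the sign, and requiring a relation with `x` cuts `ys` down to `ys₁`.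
    term-∷ : ∀ P → term ys (x ∷ P) ≡ ℤ.- term ys₁ P
    term-∷ P = begin
      -1ℤ * (-1ℤ ^ length P) * + #all (x ∷ P) ys
        ≡⟨ cong (λ zs → -1ℤ * (-1ℤ ^ length P) * + length zs) (filter-all?-∷ R? x P ys) ⟩
      -1ℤ * (-1ℤ ^ length P) * + #all P ys₁
        ≡⟨ ℤ.*-assoc -1ℤ (-1ℤ ^ length P) _ ⟩
      -1ℤ * term ys₁ P
        ≡⟨ ℤ.-1*i≡-i _ ⟩
      ℤ.- term ys₁ P ∎

    with-x : ∑ (map (x ∷_) (subsets xs)) (term ys) ≡ ℤ.- + #none xs ys₁
    with-x = begin
      ∑ (map (x ∷_) (subsets xs)) (term ys)   ≡⟨ ∑-map (x ∷_) (subsets xs) (term ys) ⟩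
      ∑ (subsets xs) (λ P → term ys (x ∷ P))  ≡⟨ ∑-cong (subsets xs) term-∷ ⟩
      ∑ (subsets xs) (λ P → ℤ.- term ys₁ P)   ≡⟨ ∑-neg (subsets xs) (term ys₁) ⟩
      ℤ.- ∑ (subsets xs) (term ys₁)           ≡⟨ cong ℤ.-_ (inclusion-exclusion xs ys₁) ⟩
      ℤ.- + #none xs ys₁                      ∎

-- Prime divisors

prime∣^⇒∣ : ∀ {q} m r → Prime q → q ∣ m ℕ.^ r → q ∣ m
prime∣^⇒∣ m zero    q-prime q∣1 = contradiction (subst Prime (∣1⇒≡1 q∣1) q-prime) ¬prime[1]
prime∣^⇒∣ m (suc r) q-prime q∣  with euclidsLemma m (m ℕ.^ r) q-prime q∣
... | inj₁ q∣m  = q∣m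
... | inj₂ q∣mʳ = prime∣^⇒∣ m r q-prime q∣mʳ

prime∣product⇒∣ : ∀ {q s} (f : Fin s → ℕ) → Prime q → q ∣ product (tabulate f) → ∃ λ i → q ∣ f i
prime∣product⇒∣ {s = zero}  f q-prime q∣1 = contradiction (subst Prime (∣1⇒≡1 q∣1) q-prime) ¬prime[1]
prime∣product⇒∣ {s = suc s} f q-prime q∣  with euclidsLemma (f zero) _ q-prime q∣
... | inj₁ q∣f₀ = zero , q∣f₀
... | inj₂ q∣fs with i , q∣fᵢ ← prime∣product⇒∣ (f ∘ suc) q-prime q∣fs = suc i , q∣fᵢ

prime∣prime⇒≡ : ∀ {q r} → Prime q → Prime r → q ∣ r → q ≡ r
prime∣prime⇒≡ q-prime r-prime q∣r with prime⇒irreducible r-prime q∣r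
... | inj₁ refl = contradiction q-prime ¬prime[1]
... | inj₂ q≡r  = q≡r

primeDivisor : ∀ n .{{_ : NonZero n}} → n ≢ 1 → ∃ λ q → Prime q × q ∣ n
primeDivisor n n≢1 with factorise n
... | record { factors = []     ; isFactorisation = n≡1 } = contradiction n≡1 n≢1
... | record { factors = q ∷ qs ; isFactorisation = n≡  ; factorsPrime = q-prime ∷ _ } =
  q , q-prime , subst (q ∣_) (sym n≡) (m∣m*n (product qs))

module _ {t} (fac : PrimeFactorization t) where
  open PrimeFactorization fac

  factor∣ : ∀ i → p i ∣ t
  factor∣ i = subst (p i ∣_) (sym factors) (∣-trans (p∣p^ (r i) (r-positive i)) (∈⇒∣product (∈-tabulate⁺ i)))
    where
    p∣p^ : ∀ e → 1 ≤ e → p i ∣ p i ℕ.^ e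
    p∣p^ (suc e) _ = m∣m*n (p i ℕ.^ e)

  -- By Euclid's lemma `q` divides some `p i ^ r i`, hence the prime `p i`. This makes the family
  -- `p` exhaust the prime divisors of `t`, so that `P*` covers every exponent `t / q`.
  prime∣⇒factor : ∀ {q} → Prime q → q ∣ t → ∃ λ i → q ≡ p i
  prime∣⇒factor q-prime q∣t
    with i , q∣ ← prime∣product⇒∣ _ q-prime (subst (_ ∣_) factors q∣t)
    = i , prime∣prime⇒≡ q-prime (p-prime i) (prime∣^⇒∣ (p i) (r i) q-prime q∣)


-- Finite cyclic groups

record IsSubgroup {c ℓ h} (𝒢 : Group c ℓ) (H : Pred (Group.Carrier 𝒢) h) : Set (c ⊔ ℓ ⊔ h) where
  open Group 𝒢
  field
    resp      : H Respects _≈_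
    ε-closed  : H ε
    ∙-closed  : ∀ {x y} → H x → H y → H (x ∙ y)
    ⁻¹-closed : ∀ {x} → H x → H (x ⁻¹)

  power-closed : ∀ {x} m → H x → H (power 𝒢 x m)
  power-closed zero    hx = ε-closed
  power-closed (suc m) hx = ∙-closed hx (power-closed m hx)

  ∙-cancelʳ : ∀ {x y} → H y → H (x ∙ y) → H x
  ∙-cancelʳ {x} {y} hy hxy = resp (GroupProperties.//-rightDividesʳ 𝒢 y x) (∙-closed hxy (⁻¹-closed hy))

module FiniteCyclic {c ℓ} (𝒢 : Group c ℓ) (g : Group.Carrier 𝒢) (t : ℕ)
                    (order : HasOrder 𝒢 t) (generates : GeneratedBy 𝒢 g) where

  open Group 𝒢 renaming (refl to ≈-refl; sym to ≈-sym; trans to ≈-trans)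
  open GroupProperties 𝒢 using (inverseˡ-unique; ∙-cancelˡ)
  open MonoidMult monoid using (×-homo-+; ×-assocˡ; ×-congˡ; ×-congʳ)
  open import Relation.Binary.Reasoning.Setoid setoid
  private
    module O = Inverse order

  ε-power : ∀ m → power 𝒢 ε m ≈ ε
  ε-power zero    = ≈-refl
  ε-power (suc m) = ≈-trans (identityˡ _) (ε-power m)

  power-∣ : ∀ {m n} → m ∣ n → power 𝒢 g m ≈ ε → power 𝒢 g n ≈ ε
  power-∣ {m} (divides k refl) gᵐ≈ε = begin
    power 𝒢 g (k ℕ.* m)       ≈⟨ ×-assocˡ g k m ⟨
    power 𝒢 (power 𝒢 g m) k   ≈⟨ ×-congʳ k gᵐ≈ε ⟩
    power 𝒢 ε k               ≈⟨ ε-power k ⟩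
    ε                         ∎

  power-+-∣ : ∀ {m n} k → m ∣ n → power 𝒢 g m ≈ ε → power 𝒢 g (k ℕ.+ n) ≈ power 𝒢 g k
  power-+-∣ {m} {n} k m∣n gᵐ≈ε = begin
    power 𝒢 g (k ℕ.+ n)         ≈⟨ ×-homo-+ g k n ⟩
    power 𝒢 g k ∙ power 𝒢 g n   ≈⟨ ∙-congˡ (power-∣ m∣n gᵐ≈ε) ⟩
    power 𝒢 g k ∙ ε             ≈⟨ identityʳ _ ⟩
    power 𝒢 g k                 ∎

  -- Any positive period of `g` turns negative exponents into natural ones. The period is arbitrary
  -- because the lemma is used before `t` is known to be one.
  ≈-ℕ-power : ∀ m .{{_ : NonZero m}} → power 𝒢 g m ≈ ε → ∀ x → ∃ λ k → x ≈ power 𝒢 g k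
  ≈-ℕ-power (suc m) gᵐ≈ε x with generates x
  ... | ℤ.+ k      , x≈ = k , x≈
  -- The period here is `suc m`, and `m * suc k + suc k` is a multiple of it, so this power is the
  -- inverse of the `suc k`-th.
  ... | ℤ.-[1+ k ] , x≈ = m ℕ.* suc k , ≈-trans x≈ (≈-sym (inverseˡ-unique _ _ eq))
    where
    eq : power 𝒢 g (m ℕ.* suc k) ∙ power 𝒢 g (suc k) ≈ ε
    eq = begin
      power 𝒢 g (m ℕ.* suc k) ∙ power 𝒢 g (suc k)  ≈⟨ ×-homo-+ g (m ℕ.* suc k) (suc k) ⟨
      power 𝒢 g (m ℕ.* suc k ℕ.+ suc k)            ≈⟨ ×-congˡ (ℕ.+-comm (m ℕ.* suc k) (suc k)) ⟩
      power 𝒢 g (suc m ℕ.* suc k)                  ≈⟨ power-∣ {suc m} (m∣m*n (suc k)) gᵐ≈ε ⟩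
      ε                                            ∎

  -- Reducing exponents modulo `m` writes each of the `t` group elements as a power of `g` with
  -- exponent below `m`; distinct elements have distinct residues. `HasOrder` speaks only of the
  -- size of the group, so this and the next lemma derive the order of `g` from it.
  power≈ε⇒t≤ : ∀ m .{{_ : NonZero m}} → power 𝒢 g m ≈ ε → t ≤ m
  power≈ε⇒t≤ m@(suc _) gᵐ≈ε = injective⇒≤ {f = residue} residue-injective
    where
    exponent : Fin t → ℕ
    exponent i = proj₁ (≈-ℕ-power m gᵐ≈ε (O.from i))

    residue : Fin t → Fin m
    residue i = fromℕ< (m%n<n (exponent i) m)

    from≈ : ∀ i → O.from i ≈ power 𝒢 g (toℕ (residue i))
    from≈ i = begin
      O.from i                                       ≈⟨ proj₂ (≈-ℕ-power m gᵐ≈ε (O.from i)) ⟩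
      power 𝒢 g (exponent i)                         ≈⟨ ×-congˡ (m≡m%n+[m/n]*n (exponent i) m) ⟩
      power 𝒢 g (exponent i % m ℕ.+ exponent i / m ℕ.* m)
        ≈⟨ power-+-∣ (exponent i % m) (divides (exponent i / m) refl) gᵐ≈ε ⟩
      power 𝒢 g (exponent i % m)                     ≈⟨ ×-congˡ (toℕ-fromℕ< (m%n<n (exponent i) m)) ⟨
      power 𝒢 g (toℕ (residue i))                    ∎

    residue-injective : ∀ {i j} → residue i ≡ residue j → i ≡ j
    residue-injective {i} {j} eq = trans (sym (O.strictlyInverseˡ i)) (trans (O.to-cong from≈from) (O.strictlyInverseˡ j))
      where
      from≈from : O.from i ≈ O.from j
      from≈from = begin
        O.from i                      ≈⟨ from≈ i ⟩
        power 𝒢 g (toℕ (residue i))   ≈⟨ ×-congˡ (cong toℕ eq) ⟩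
        power 𝒢 g (toℕ (residue j))   ≈⟨ from≈ j ⟨
        O.from j                      ∎

  -- Among the `t + 1` powers with exponents 0 to `t` two coincide. Their exponents differ by some
  -- positive `d ≤ t` with `power 𝒢 g d ≈ ε`, and the previous bound forces `d ≡ t`.
  power-t≈ε : power 𝒢 g t ≈ ε
  power-t≈ε with i , j , i<j , eq ← pigeonhole (ℕ.n<1+n t) (λ i → O.to (power 𝒢 g (toℕ i)))
    = subst (λ m → power 𝒢 g m ≈ ε) (ℕ.≤-antisym d≤t (power≈ε⇒t≤ d {{>-nonZero (ℕ.m<n⇒0<n∸m i<j)}} gᵈ≈ε)) gᵈ≈ε
    where
    d : ℕ
    d = toℕ j ∸ toℕ i

    d≤t : d ≤ t
    d≤t = ℕ.≤-trans (ℕ.m∸n≤m (toℕ j) (toℕ i)) (ℕ.≤-pred (toℕ<n j))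

    gⁱ≈gʲ : power 𝒢 g (toℕ i) ≈ power 𝒢 g (toℕ j)
    gⁱ≈gʲ = begin
      power 𝒢 g (toℕ i)                  ≈⟨ O.strictlyInverseʳ _ ⟨
      O.from (O.to (power 𝒢 g (toℕ i)))  ≈⟨ O.from-cong eq ⟩
      O.from (O.to (power 𝒢 g (toℕ j)))  ≈⟨ O.strictlyInverseʳ _ ⟩
      power 𝒢 g (toℕ j)                  ∎

    gᵈ≈ε : power 𝒢 g d ≈ ε
    gᵈ≈ε = ∙-cancelˡ (power 𝒢 g (toℕ i)) _ _ (begin
      power 𝒢 g (toℕ i) ∙ power 𝒢 g d  ≈⟨ ×-homo-+ g (toℕ i) d ⟨
      power 𝒢 g (toℕ i ℕ.+ d)          ≈⟨ ×-congˡ (ℕ.m+[n∸m]≡n (ℕ.<⇒≤ i<j)) ⟩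
      power 𝒢 g (toℕ j)                ≈⟨ gⁱ≈gʲ ⟨
      power 𝒢 g (toℕ i)                ≈⟨ identityʳ _ ⟨
      power 𝒢 g (toℕ i) ∙ ε            ∎)

  instance
    t-nonZero : NonZero t
    -- The index of the identity inhabits `Fin t`.
    t-nonZero = nonZeroIndex (O.to ε)

  -- The exponent lies strictly between 0 and `t`, whereas `t` is the least positive period.
  power-t/≉ε : ∀ {q} (q-prime : Prime q) → q ∣ t →
    ¬ power 𝒢 g (_/_ t q {{prime⇒nonZero q-prime}}) ≈ ε
  power-t/≉ε {q} q-prime q∣t eq =
    ℕ.<⇒≱ (m/n<m t q (nonTrivial⇒n>1 q)) (power≈ε⇒t≤ (t / q) {{>-nonZero (m≥n⇒m/n>0 (∣⇒≤ q∣t))}} eq)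
    where
    instance
      q-nonZero = prime⇒nonZero q-prime
      q-nonTrivial = prime⇒nonTrivial q-prime

  module _ {h} {H : Pred Carrier h} (H-subgroup : IsSubgroup 𝒢 H) where
    open IsSubgroup H-subgroup

    power-∣-closed : ∀ {m n} → m ∣ n → H (power 𝒢 g m) → H (power 𝒢 g n)
    power-∣-closed {m} (divides k refl) hm = resp (×-assocˡ g k m) (power-closed k hm)

    power-gcd-closed : ∀ m → H (power 𝒢 g m) → H (power 𝒢 g (gcd m t))
    power-gcd-closed m hm with Bézout.identity (gcd-GCD m t)
    -- Bézout over the naturals has two sign cases. Here `gcd m t + y * t ≡ x * m`, so the `gcd`
    -- power equals the `x * m` power.
    ... | Bézout.+- x y eq = resp
      (≈-trans (×-congˡ (sym eq)) (power-+-∣ (gcd m t) (divides y refl) power-t≈ε))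
      (power-∣-closed (divides x refl) hm)
    -- Here `gcd m t + x * m ≡ y * t`, so the `gcd` power times an element of `H` is the identity,
    -- and that element can be cancelled.
    ... | Bézout.-+ x y eq = ∙-cancelʳ (power-∣-closed (divides x refl) hm)
      (resp (≈-sym (begin
          power 𝒢 g (gcd m t) ∙ power 𝒢 g (x ℕ.* m)  ≈⟨ ×-homo-+ g (gcd m t) (x ℕ.* m) ⟨
          power 𝒢 g (gcd m t ℕ.+ x ℕ.* m)            ≈⟨ ×-congˡ eq ⟩
          power 𝒢 g (y ℕ.* t)                        ≈⟨ power-∣ (divides y refl) power-t≈ε ⟩
          ε                                          ∎))
        ε-closed)

    -- The elements excluded by the hypothesis generate the subgroups of prime order, and every
    -- nontrivial subgroup contains one of these.
    subgroup-trivial : (∀ {q} (q-prime : Prime q) → q ∣ t →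
                          ¬ H (power 𝒢 g (_/_ t q {{prime⇒nonZero q-prime}}))) →
                       ∀ {x} → H x → x ≈ ε
    subgroup-trivial minimal∉H {x} hx
      with m , x≈gᵐ ← ≈-ℕ-power t power-t≈ε x
      -- This quotient is `t / gcd m t`. If it is 1 then `t` divides `m`; otherwise it has a prime
      -- divisor `q`, and `gcd m t * q ∣ t` gives `gcd m t ∣ t / q`.
      with quotient (gcd[m,n]∣n m t) ℕ.≟ 1
    ... | yes k≡1 = ≈-trans x≈gᵐ (power-∣ t∣m power-t≈ε)
      where
      t≡d : t ≡ gcd m t
      t≡d = trans (m∣n⇒n≡m*quotient (gcd[m,n]∣n m t)) (trans (cong (gcd m t ℕ.*_) k≡1) (ℕ.*-identityʳ _))
      t∣m : t ∣ m
      t∣m = subst (_∣ m) (sym t≡d) (gcd[m,n]∣m m t)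
    ... | no k≢1
      with q , q-prime , q∣k ← primeDivisor _ {{quotient≢0 (gcd[m,n]∣n m t)}} k≢1
      = contradiction (power-∣-closed (m*n∣o⇒m∣o/n d q {{prime⇒nonZero q-prime}} dq∣t)
                                      (power-gcd-closed m (resp x≈gᵐ hx)))
                      (minimal∉H q-prime (∣-trans (divides d refl) dq∣t))
      where
      d : ℕ
      d = gcd m t
      dq∣t : d ℕ.* q ∣ t
      dq∣t = subst (d ℕ.* q ∣_) (sym (m∣n⇒n≡m*quotient (gcd[m,n]∣n m t))) (*-monoʳ-∣ d q∣k)

-- Labelings

module _ {n} (G : Graph n) where
  open Automorphism

  stabilizer-isSubgroup : ∀ {k} (φ : Labeling n k) → IsSubgroup (Aut G) (λ σ → Preserves G σ φ)
  stabilizer-isSubgroup φ = record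
    { resp      = λ σ≈τ pres v → trans (cong φ (sym (σ≈τ v))) (pres v)
    ; ε-closed  = λ _ → refl
    ; ∙-closed  = λ {_} {τ} presσ presτ v → trans (presσ (τ .perm ⟨$⟩ʳ v)) (presτ v)
    ; ⁻¹-closed = λ {σ} pres v → trans (sym (pres (σ .perm ⟨$⟩ˡ v))) (cong φ (inverseʳ (σ .perm)))
    }

  module _ (t : ℕ) (π : Automorphism G) (order : HasOrder (Aut G) t)
           (generates : GeneratedBy (Aut G) π) (fac : PrimeFactorization t) where
    open PrimeFactorization fac
    open FiniteCyclic (Aut G) π t order generates

    P*-element : Fin s → Automorphism G
    P*-element i = power (Aut G) π (_/_ t (p i) {{prime⇒nonZero (p-prime i)}})

    distinguishing≐preservedByNone : ∀ {k} →
      Distinguishing G {k} ≐ (λ φ → All (λ σ → ¬ Preserves G σ φ) (P* G π fac))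
    distinguishing≐preservedByNone {k} = (λ {φ} → to φ) , (λ {φ} → from φ)
      where
      to : ∀ (φ : Labeling n k) → Distinguishing G φ → All (λ σ → ¬ Preserves G σ φ) (P* G π fac)
      to φ dist = All.deduplicate⁺ (_≈?_ G) (All.tabulate⁺ λ i pres →
        power-t/≉ε (p-prime i) (factor∣ fac i) (dist (P*-element i) pres))

      from : ∀ (φ : Labeling n k) → All (λ σ → ¬ Preserves G σ φ) (P* G π fac) → Distinguishing G φ
      from φ none σ = subgroup-trivial (stabilizer-isSubgroup φ) minimal {σ}
        where
        open IsSubgroup (stabilizer-isSubgroup φ)
        none′ : ∀ i → ¬ Preserves G (P*-element i) φ
        -- An entry dropped from `P*` as a repetition is `≈` to one that was kept, and preserving
        -- `φ` depends only on the `≈`-class.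
        none′ = All.tabulate⁻ (All.deduplicate⁻ (_≈?_ G)
          (λ {σ} {τ} σ≈τ ¬pres → ¬pres ∘ resp {τ} {σ} (λ v → sym (σ≈τ v))) _ none)

        minimal : ∀ {q} (q-prime : Prime q) → q ∣ t →
                  ¬ Preserves G (power (Aut G) π (_/_ t q {{prime⇒nonZero q-prime}})) φ
        minimal q-prime q∣t with i , refl ← prime∣⇒factor fac q-prime q∣t = none′ i

theorem2 : ∀ {n : ℕ} (G : Graph n) (t : ℕ) (π : Automorphism G) →
    HasOrder (Aut G) t → GeneratedBy (Aut G) π →
    (fac : PrimeFactorization t) →
    ∀ (k : ℕ) → 1 ≤ k →
    + (L G k) ≡ ∑ (subsets (P* G π fac)) (λ P → (-1ℤ ^ length P) * + (N≥ G k P))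
theorem2 {n} G t π order generates fac k _ = trans
  (cong (+_ ∘ length) (filter-≐ (distinguishing? G) (λ φ → All.all? (λ σ → ¬? (preserves? G σ φ)) (P* G π fac))
    (distinguishing≐preservedByNone G t π order generates fac) (labelings n k)))
  -- With the relation "`σ` preserves `φ`", `#all P` on the list of all labelings unfolds to
  -- `N≥ G k P`.
  (sym (inclusion-exclusion (preserves? G) (P* G π fac) (labelings n k)))
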